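{- Let $n\ge1$. The map $$\Psi_{1,n}\colon\operatorname{Ch}\bigl(\mathcal H_n^{(1)}\bigr)\longrightarrow\{\mathtt a,\mathtt b\}^n/{\sim_1},\qquad C\longmapsto[\,\mathtt b^{\,n-r(C)}\mathtt a^{\,r(C)}\,]_{\sim_1},$$ is a bijection.
   Context: $\mathcal H_n^{(1)}$ is the arrangement in $\mathbb R$ of the points $H_i^{(1)}=\{x\in\mathbb R:1+ix=0\}$, $i\in\{1,\dots,n\}$. A chamber is a connected component of $\mathbb R\setminus\bigcup_iH_i^{(1)}$, and $\operatorname{Ch}(\mathcal H_n^{(1)})$ is the set of chambers. The sign word of a chamber $C$ is $\sigma(C)=\sigma_1\cdots\sigma_n\in\{+,-\}^n$ with $\sigma_i=\operatorname{sgn}(1+ix)$ for any $x\in C$. Each chamber sign word has the form ${+}^{\,n-r(C)}{ - }^{\,r(C)}$ with $r(C)\in\{0,\dots,n\}$; this defines $r(C)$. For $u,w\in\{\mathtt a,\mathtt b\}^n$, $u\sim_1w$ (abelian equivalence) means that $u$ and $w$ have the same number of letters $\mathtt a$; $[w]_{\sim_1}$ is the class of $w$. -}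

module Defs where

open import Algebra.Bundles.Raw using (RawMonoid)
import Algebra.Definitions.RawMonoid as RawMonoidDefinitions
open import Data.Empty using (⊥-elim)
open import Data.Fin.Base as Fin using (Fin; zero; suc; toℕ; inject₁)
open import Data.Fin.Properties using (toℕ≤pred[n]; toℕ-inject₁; toℕ-fromℕ)
import Data.List.Base as List
open import Data.Nat.Base as ℕ using (ℕ; zero; suc; _∸_)
open import Data.Nat.Properties as ℕₚ using (m∸n+n≡m; +-∸-assoc)
open import Data.Product.Base using (∃; ∃-syntax; ∃₂; _×_; _,_; proj₁; proj₂)
open import Data.Rational.Base as ℚ using (ℚ; 0ℚ; 1ℚ; ½)
import Data.Rational.Properties as ℚₚ
open import Data.Rational.Solver using (module +-*-Solver)
open import Data.Sign.Base using (Sign; +; -)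
open import Data.Sum.Base using (_⊎_; inj₁; inj₂)
open import Data.Unit.Base using (⊤; tt)
open import Data.Vec.Base
  using (Vec; []; _∷_; _++_; replicate; cast; count; tabulate; lookup; toList)
open import Data.Vec.Properties
  using (lookup∘tabulate; cast-is-id; toList-injective; toList-cast; toList-++; toList-replicate)
open import Level using (0ℓ; Lift; lift) renaming (suc to lsuc)
open import Relation.Binary.Core using (Rel)
open import Relation.Binary.Definitions using (DecidableEquality; tri<; tri≈; tri>)
open import Relation.Binary.PropositionalEquality
  using (_≡_; refl; sym; trans; cong; cong₂; subst; module ≡-Reasoning)
open import Relation.Nullary using (¬_; yes; no)
open import Relation.Unary using (Pred; _⊆_; _≐_; _∪_; _∩_; Satisfiable)

-- Two-sided Dedekind cuts. `located` makes the two halves arbitrarily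
-- close; in particular both are inhabited, and p < q implies Lo p or
-- Hi q (`compare` below).

record ℝ : Set₁ where
  field
    Lo Hi    : Pred ℚ 0ℓ
    lo-down  : ∀ {p q} → p ℚ.< q → Lo q → Lo p
    lo-open  : ∀ {p} → Lo p → ∃[ q ] p ℚ.< q × Lo q
    hi-up    : ∀ {p q} → p ℚ.< q → Hi p → Hi q
    hi-open  : ∀ {q} → Hi q → ∃[ p ] p ℚ.< q × Hi p
    disjoint : ∀ {p} → ¬ (Lo p × Hi p)
    located  : ∀ {ε} → 0ℚ ℚ.< ε → ∃[ p ] Lo p × Hi (p ℚ.+ ε)

open ℝ

infix 4 _≈_ _<_ _#_

_≈_ : Rel ℝ 0ℓ
x ≈ y = Lo x ≐ Lo y × Hi x ≐ Hi y

_<_ : Rel ℝ 0ℓ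
x < y = ∃[ q ] Hi x q × Lo y q

_#_ : Rel ℝ 0ℓ
x # y = x < y ⊎ y < x

lo<hi : ∀ x {p q} → Lo x p → Hi x q → p ℚ.< q
lo<hi x {p} {q} l h with ℚₚ.<-cmp p q
... | tri< p<q _ _ = p<q
... | tri≈ _ refl _ = ⊥-elim (disjoint x (l , h))
... | tri> _ _ q<p = ⊥-elim (disjoint x (lo-down x q<p l , h))

shift : ∀ p q → p ℚ.+ (q ℚ.- p) ≡ q
shift = solve 2 (λ p q → p :+ (q :- p) := q) refl
  where open +-*-Solver

0<q-p : ∀ {p q} → p ℚ.< q → 0ℚ ℚ.< q ℚ.- p
0<q-p {p} {q} p<q =
  subst (ℚ._< q ℚ.- p) (ℚₚ.+-inverseʳ p) (ℚₚ.+-monoˡ-< (ℚ.- p) p<q)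

p-ε<p : ∀ p {ε} → 0ℚ ℚ.< ε → p ℚ.- ε ℚ.< p
p-ε<p p {ε} 0<ε =
  subst (p ℚ.- ε ℚ.<_) (ℚₚ.+-identityʳ p)
    (ℚₚ.+-monoʳ-< p (ℚₚ.neg-antimono-< 0<ε))

p<p+ε : ∀ p {ε} → 0ℚ ℚ.< ε → p ℚ.< p ℚ.+ ε
p<p+ε p {ε} 0<ε =
  subst (ℚ._< p ℚ.+ ε) (ℚₚ.+-identityʳ p) (ℚₚ.+-monoʳ-< p 0<ε)

0<½ε : ∀ {ε} → 0ℚ ℚ.< ε → 0ℚ ℚ.< ½ ℚ.* ε
0<½ε 0<ε = ℚₚ.*-monoʳ-<-pos ½ 0<ε

halves : ∀ a b ε → (a ℚ.+ b) ℚ.+ ε ≡ (a ℚ.+ ½ ℚ.* ε) ℚ.+ (b ℚ.+ ½ ℚ.* ε)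
halves = solve 3 (λ a b ε →
    (a :+ b) :+ ε := (a :+ con ½ :* ε) :+ (b :+ con ½ :* ε)) refl
  where open +-*-Solver

split : ∀ a b q′ → q′ ≡ a ℚ.+ (b ℚ.+ (q′ ℚ.- (a ℚ.+ b)))
split = solve 3 (λ a b q′ → q′ := a :+ (b :+ (q′ :- (a :+ b)))) refl
  where open +-*-Solver

lower : ∀ b {q q′} → q′ ℚ.< q → b ℚ.+ (q′ ℚ.- q) ℚ.< b
lower b {q} {q′} q′<q = subst (b ℚ.+ (q′ ℚ.- q) ℚ.<_) (ℚₚ.+-identityʳ b)
  (ℚₚ.+-monoʳ-< b
    (subst (q′ ℚ.- q ℚ.<_) (ℚₚ.+-inverseʳ q) (ℚₚ.+-monoˡ-< (ℚ.- q) q′<q)))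

compare : ∀ x {p q} → p ℚ.< q → Lo x p ⊎ Hi x q
compare x {p} {q} p<q with located x (0<q-p p<q)
... | a , la , ha with ℚₚ.<-cmp p a
...   | tri< p<a _ _ = inj₁ (lo-down x p<a la)
...   | tri≈ _ refl _ = inj₁ la
...   | tri> _ _ a<p =
        inj₂ (subst (Hi x) (shift p q) (hi-up x (ℚₚ.+-monoˡ-< (q ℚ.- p) a<p) ha))

-- Hence, classically, _#_ is the negation of _≈_.

#-tight : ∀ x y → ¬ (x # y) → x ≈ y
#-tight x y ¬x#y =
    (lo x y (λ y<x → ¬x#y (inj₂ y<x)) , lo y x (λ x<y → ¬x#y (inj₁ x<y)))
  , (hi x y (λ x<y → ¬x#y (inj₁ x<y)) , hi y x (λ y<x → ¬x#y (inj₂ y<x)))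
  where
  lo : ∀ x y → ¬ (y < x) → Lo x ⊆ Lo y
  lo x y y≮x l with lo-open x l
  ... | q , p<q , lq with compare y p<q
  ...   | inj₁ l′ = l′
  ...   | inj₂ h′ = ⊥-elim (y≮x (q , h′ , lq))
  hi : ∀ x y → ¬ (x < y) → Hi x ⊆ Hi y
  hi x y x≮y h with hi-open x h
  ... | p , p<q , hp with compare y p<q
  ...   | inj₁ l′ = ⊥-elim (x≮y (p , hp , l′))
  ...   | inj₂ h′ = h′

#⇒≉ : ∀ x y → x # y → ¬ (x ≈ y)
#⇒≉ x y (inj₁ (q , h , l)) ((_ , ⊇) , _) = disjoint x (⊇ l , h)
#⇒≉ x y (inj₂ (q , h , l)) (_ , (_ , ⊇)) = disjoint x (l , ⊇ h)

fromℚ : ℚ → ℝ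
fromℚ r = record
  { Lo       = ℚ._< r
  ; Hi       = r ℚ.<_
  ; lo-down  = ℚₚ.<-trans
  ; lo-open  = λ p<r → let m , p<m , m<r = ℚₚ.<-dense p<r in m , p<m , m<r
  ; hi-up    = λ p<q r<p → ℚₚ.<-trans r<p p<q
  ; hi-open  = λ r<q → let m , r<m , m<q = ℚₚ.<-dense r<q in m , m<q , r<m
  ; disjoint = λ (p<r , r<p) → ℚₚ.<-asym p<r r<p
  ; located  = λ {ε} 0<ε →
      r ℚ.- ½ ℚ.* ε , p-ε<p r (0<½ε 0<ε)
      , subst (r ℚ.<_) (half r ε) (p<p+ε r (0<½ε 0<ε))
  }
  where
  half : ∀ r ε → r ℚ.+ ½ ℚ.* ε ≡ (r ℚ.- ½ ℚ.* ε) ℚ.+ ε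
  half = solve 2 (λ r ε → r :+ con ½ :* ε := (r :- con ½ :* ε) :+ ε) refl
    where open +-*-Solver

0ℝ 1ℝ : ℝ
0ℝ = fromℚ 0ℚ
1ℝ = fromℚ 1ℚ

infixl 6 _+ℝ_

_+ℝ_ : ℝ → ℝ → ℝ
x +ℝ y = record
  { Lo       = λ q → ∃₂ λ a b → Lo x a × Lo y b × q ≡ a ℚ.+ b
  ; Hi       = λ q → ∃₂ λ a b → Hi x a × Hi y b × q ≡ a ℚ.+ b
  ; lo-down  = λ { {p} p<q (a , b , la , lb , refl) →
      a , _ , la , lo-down y (lower b p<q) lb , split a b p }
  ; lo-open  = λ { (a , b , la , lb , refl) →
      let a′ , a<a′ , la′ = lo-open x la
      in a′ ℚ.+ b , ℚₚ.+-monoˡ-< b a<a′ , a′ , b , la′ , lb , refl }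
  ; hi-up    = λ { {_} {q} p<q (a , b , ha , hb , refl) →
      a , _ , ha , hi-up y (p<p+ε b (0<q-p p<q)) hb , split a b q }
  ; hi-open  = λ { (a , b , ha , hb , refl) →
      let a′ , a′<a , ha′ = hi-open x ha
      in a′ ℚ.+ b , ℚₚ.+-monoˡ-< b a′<a , a′ , b , ha′ , hb , refl }
  ; disjoint = λ { ((a , b , la , lb , p≡a+b) , (c , d , hc , hd , p≡c+d)) →
      ℚₚ.<-irrefl (trans (sym p≡a+b) p≡c+d)
        (ℚₚ.+-mono-< (lo<hi x la hc) (lo<hi y lb hd)) }
  ; located  = λ {ε} 0<ε →
      let a , la , ha = located x (0<½ε 0<ε)
          b , lb , hb = located y (0<½ε 0<ε)
      in a ℚ.+ b , (a , b , la , lb , refl) , (_ , _ , ha , hb , halves a b ε)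
  }

+-0-rawMonoid : RawMonoid (lsuc 0ℓ) 0ℓ
+-0-rawMonoid = record { Carrier = ℝ ; _≈_ = _≈_ ; _∙_ = _+ℝ_ ; ε = 0ℝ }

open RawMonoidDefinitions +-0-rawMonoid public using () renaming (_×_ to _·_)

Subset : Set₂
Subset = Pred ℝ (lsuc 0ℓ)

-- Open rational intervals form a base.

Open : Subset → Set₁
Open U = ∀ {x} → U x →
  ∃₂ λ p q → Lo x p × Hi x q × (∀ {y} → Lo y p → Hi y q → U y)

-- No two disjoint open sets that both meet C cover C.

Connected : Subset → Set₂
Connected C = ∀ {U V} → Open U → Open V → C ⊆ U ∪ V →
  Satisfiable (C ∩ U) → Satisfiable (C ∩ V) → Satisfiable (C ∩ (U ∩ V))

record ConnectedComponent (X : Subset) : Set₂ where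
  field
    carrier   : Subset
    inhabited : Satisfiable carrier
    contained : carrier ⊆ X
    connected : Connected carrier
    maximal   : ∀ {D} → D ⊆ X → Connected D → carrier ⊆ D → D ⊆ carrier

open ConnectedComponent public

-- 1 + i x, where the index i ∈ {1, …, n} is encoded as suc (toℕ i).

form : ∀ {n} → Fin n → ℝ → ℝ
form i x = 1ℝ +ℝ suc (toℕ i) · x

H : ∀ {n} → Fin n → Pred ℝ 0ℓ
H i x = form i x ≈ 0ℝ

-- The complement of ⋃ᵢ H i, with x ∉ H i read positively as apartness
-- of 1 + i x from 0 (see #-tight and #⇒≉): the sign of a real is only
-- defined constructively when it is apart from 0.

Complement : ℕ → Subset
Complement n x = Lift (lsuc 0ℓ) (∀ (i : Fin n) → form i x # 0ℝ)

Complement-avoids-H : ∀ {n} x → Complement n x → ∀ i → ¬ H {n} i x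
Complement-avoids-H x (lift x#) i = #⇒≉ (form i x) 0ℝ (x# i)

Chamber : ℕ → Set₂
Chamber n = ConnectedComponent (Complement n)

-- Chambers are equal when they have the same points.

infix 4 _≈ᶜ_

_≈ᶜ_ : ∀ {n} → Rel (Chamber n) (lsuc 0ℓ)
C ≈ᶜ D = carrier C ≐ carrier D

sgn : ∀ x → x # 0ℝ → Sign
sgn x (inj₁ x<0) = -
sgn x (inj₂ 0<x) = +

signs : ∀ {n} x → Complement n x → Vec Sign n
signs x (lift x#) = tabulate λ i → sgn (form i x) (x# i)

-- The sign word read off at the witness of inhabitation. _≈ᶜ_ ignores
-- this witness, so congruence of Ψ includes independence of the point.

σ : ∀ {n} → Chamber n → Vec Sign n
σ C = let x , x∈C = inhabited C in signs x (contained C x∈C)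

-- blocks x y r is the word xⁿ⁻ʳ yʳ of length n.

blocks : ∀ {a} {A : Set a} {n} → A → A → Fin (suc n) → Vec A n
blocks {n = n} x y r =
  cast (m∸n+n≡m (toℕ≤pred[n] r)) (replicate (n ∸ toℕ r) x ++ replicate (toℕ r) y)

Hi-·-neg : ∀ n x {b} → b ℚ.< 0ℚ → Hi (n · x) b → Hi x 0ℚ
Hi-·-neg zero    x b<0 0<b = ⊥-elim (ℚₚ.<-asym b<0 0<b)
Hi-·-neg (suc n) x b<0 (c , d , hc , hd , refl) with ℚₚ.<-cmp c 0ℚ
... | tri< c<0 _ _  = hi-up x c<0 hc
... | tri≈ _ refl _ = hc
... | tri> _ _ 0<c  = Hi-·-neg n x
  (ℚₚ.<-trans (subst (ℚ._< c ℚ.+ d) (ℚₚ.+-identityˡ d) (ℚₚ.+-monoˡ-< d 0<c)) b<0) hd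

neg-step : ∀ k x → 1ℝ +ℝ k · x < 0ℝ → 1ℝ +ℝ suc k · x < 0ℝ
neg-step k x (q , (a , b , 1<a , hb , q≡a+b) , q<0)
  with hi-open x (Hi-·-neg k x b<0 hb)
  where
  a+b<0 : a ℚ.+ b ℚ.< 0ℚ
  a+b<0 = subst (ℚ._< 0ℚ) q≡a+b q<0
  b<0 : b ℚ.< 0ℚ
  b<0 = ℚₚ.<-trans
    (subst (ℚ._< a ℚ.+ b) (ℚₚ.+-identityˡ b)
      (ℚₚ.+-monoˡ-< b (ℚₚ.<-trans (ℚₚ.positive⁻¹ 1ℚ) 1<a)))
    a+b<0
... | c , c<0 , hc =
  a ℚ.+ (c ℚ.+ b) , (a , _ , 1<a , (c , b , hc , hb , refl) , refl)
  , ℚₚ.<-trans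
      (ℚₚ.+-monoʳ-< a (subst (c ℚ.+ b ℚ.<_) (ℚₚ.+-identityˡ b) (ℚₚ.+-monoˡ-< b c<0)))
      (subst (ℚ._< 0ℚ) q≡a+b q<0)

sgn- : ∀ x (x# : x # 0ℝ) → sgn x x# ≡ - → x < 0ℝ
sgn- x (inj₁ x<0) refl = x<0

sgn-neg : ∀ x → x < 0ℝ → (x# : x # 0ℝ) → sgn x x# ≡ -
sgn-neg x x<0 (inj₁ _) = refl
sgn-neg x (q , hx , q<0) (inj₂ (p , 0<p , lx)) =
  ⊥-elim (ℚₚ.<-asym (lo<hi x lx hx) (ℚₚ.<-trans q<0 0<p))

Descending : ∀ {n} → Vec Sign n → Set
Descending {zero}  w = ⊤
Descending {suc n} w =
  ∀ (i : Fin n) → lookup w (inject₁ i) ≡ - → lookup w (suc i) ≡ -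

toList-blocks : ∀ {n} (r : Fin (suc n)) →
  toList (blocks + - r) ≡
  List.replicate (n ∸ toℕ r) + List.++ List.replicate (toℕ r) -
toList-blocks {n} r = begin
  toList (blocks + - r)
    ≡⟨ toList-cast (m∸n+n≡m (toℕ≤pred[n] r)) (replicate (n ∸ toℕ r) + ++ replicate (toℕ r) -) ⟩
  toList (replicate (n ∸ toℕ r) + ++ replicate (toℕ r) -)
    ≡⟨ toList-++ (replicate (n ∸ toℕ r) +) _ ⟩
  toList (replicate (n ∸ toℕ r) +) List.++ toList (replicate (toℕ r) -)
    ≡⟨ cong₂ List._++_ (toList-replicate (n ∸ toℕ r) +) (toList-replicate (toℕ r) -) ⟩
  List.replicate (n ∸ toℕ r) + List.++ List.replicate (toℕ r) - ∎
  where open ≡-Reasoning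

toList-inj : ∀ {n} (v w : Vec Sign n) → toList v ≡ toList w → v ≡ w
toList-inj v w eq = trans (sym (cast-is-id refl v)) (toList-injective refl v w eq)

tail-descending : ∀ {n} s (w : Vec Sign n) → Descending (s ∷ w) → Descending w
tail-descending {zero}  s w d = tt
tail-descending {suc n} s w d i = d (suc i)

all-neg : ∀ {n} (w : Vec Sign n) → Descending (- ∷ w) → w ≡ replicate n -
all-neg []      d = refl
all-neg (- ∷ w) d = cong (- ∷_) (all-neg w (tail-descending - (- ∷ w) d))
all-neg (+ ∷ w) d with () ← d zero refl

descending⇒blocks : ∀ {n} (w : Vec Sign n) → Descending w → ∃[ r ] w ≡ blocks + - r
descending⇒blocks [] d = zero , refl
descending⇒blocks {suc n} (- ∷ w) d =
  Fin.fromℕ (suc n) , toList-inj (- ∷ w) _ (begin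
    toList (- ∷ w)
      ≡⟨ cong (λ v → toList (- ∷ v)) (all-neg w d) ⟩
    toList (replicate (suc n) -)
      ≡⟨ toList-replicate (suc n) - ⟩
    List.replicate (suc n) -
      ≡⟨ cong₂ (λ k l → List.replicate k + List.++ List.replicate l -)
           (sym (trans (cong (suc n ∸_) (toℕ-fromℕ (suc n))) (ℕₚ.n∸n≡0 n)))
           (sym (toℕ-fromℕ (suc n))) ⟩
    List.replicate (suc n ∸ toℕ (Fin.fromℕ (suc n))) +
      List.++ List.replicate (toℕ (Fin.fromℕ (suc n))) -
      ≡⟨ toList-blocks (Fin.fromℕ (suc n)) ⟨
    toList (blocks + - (Fin.fromℕ (suc n))) ∎)
  where open ≡-Reasoning
descending⇒blocks {suc n} (+ ∷ w) d
  with descending⇒blocks w (tail-descending + w d)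
... | r , w≡ = inject₁ r , toList-inj (+ ∷ w) _ (begin
    + List.∷ toList w
      ≡⟨ cong (λ v → + List.∷ toList v) w≡ ⟩
    + List.∷ toList (blocks + - r)
      ≡⟨ cong (+ List.∷_) (toList-blocks r) ⟩
    List.replicate (suc (n ∸ toℕ r)) + List.++ List.replicate (toℕ r) -
      ≡⟨ cong₂ (λ k l → List.replicate k + List.++ List.replicate l -)
           (trans (sym (+-∸-assoc 1 (toℕ≤pred[n] r))) (cong (suc n ∸_) (sym (toℕ-inject₁ r))))
           (sym (toℕ-inject₁ r)) ⟩
    List.replicate (suc n ∸ toℕ (inject₁ r)) +
      List.++ List.replicate (toℕ (inject₁ r)) -
      ≡⟨ toList-blocks (inject₁ r) ⟨
    toList (blocks + - (inject₁ r)) ∎)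
  where open ≡-Reasoning

signs-descending : ∀ {n} x (x∈ : Complement n x) → Descending (signs x x∈)
signs-descending {zero}  x x∈ = tt
signs-descending {suc n} x (lift x#) i eq =
  trans (lookup∘tabulate s (suc i)) (sgn-neg (form (suc i) x) next (x# (suc i)))
  where
  s : Fin (suc n) → Sign
  s j = sgn (form j x) (x# j)
  here : 1ℝ +ℝ suc (toℕ i) · x < 0ℝ
  here = subst (λ k → 1ℝ +ℝ suc k · x < 0ℝ) (toℕ-inject₁ i)
    (sgn- (form (inject₁ i) x) (x# (inject₁ i))
      (trans (sym (lookup∘tabulate s (inject₁ i))) eq))
  next : 1ℝ +ℝ suc (suc (toℕ i)) · x < 0ℝ
  next = neg-step (suc (toℕ i)) x here

σ-blocks : ∀ {n} (C : Chamber n) → ∃[ r ] σ C ≡ blocks + - r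
σ-blocks C = let x , x∈C = inhabited C in
  descending⇒blocks (σ C) (signs-descending x (contained C x∈C))

r : ∀ {n} → Chamber n → Fin (suc n)
r C = proj₁ (σ-blocks C)

data Letter : Set where
  𝕒 𝕓 : Letter

_≟_ : DecidableEquality Letter
𝕒 ≟ 𝕒 = yes refl
𝕒 ≟ 𝕓 = no λ ()
𝕓 ≟ 𝕒 = no λ ()
𝕓 ≟ 𝕓 = yes refl

Word : ℕ → Set
Word = Vec Letter

infix 4 _∼₁_

_∼₁_ : ∀ {n} → Rel (Word n) 0ℓ
u ∼₁ w = count (𝕒 ≟_) u ≡ count (𝕒 ≟_) w

-- The class of bⁿ⁻ʳ aʳ, given by this representative; the codomain is
-- Word n with equality _∼₁_.

Ψ : ∀ n → Chamber n → Word n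
Ψ n C = blocks 𝕓 𝕒 (r C)

-- Writing ρ i for the root of 1 + i x, the sign of 1 + i x is + exactly
-- when ρ i < x, so a sign word w cuts out a convex open set, the cell of
-- w. Convex open sets are connected (bisection), and a connected set
-- avoiding all the roots lies in a single cell. Hence the chambers are
-- precisely the inhabited cells. As the roots increase, each word
-- +ⁿ⁻ʳ -ʳ has an inhabited cell: choose a point after the first n - r
-- roots and before the others.

module Submission where

open import Defs
open import Data.Nat.Base using (ℕ; _≥_)
open import Function.Structures using (IsBijection)

open import Algebra.Bundles using (CommutativeRing)
import Algebra.Definitions.RawMonoid as RawMonoidDefinitions
import Algebra.Properties.Semiring.Mult as SemiringMult
open import Data.Empty using (⊥-elim)
open import Data.Fin.Base as Fin using (Fin; zero; suc; toℕ)
open import Data.Fin.Properties using (toℕ-fromℕ<; toℕ-injective; toℕ≤pred[n]; toℕ-cast)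
open import Data.Integer.Base as ℤ using ()
import Data.Integer.Properties as ℤₚ
open import Data.Nat.Base as ℕ using (zero; suc; _∸_)
import Data.Nat.Properties as ℕₚ
open import Data.Product.Base using (∃-syntax; _×_; _,_; proj₁; proj₂)
open import Data.Rational.Base as ℚ using (ℚ; mkℚ; 0ℚ; 1ℚ; ½)
import Data.Rational.Properties as ℚₚ
open import Data.Rational.Solver using (module +-*-Solver)
open import Data.Rational.Unnormalised.Base as ℚᵘ using (mkℚᵘ; *≡*)
import Data.Rational.Unnormalised.Properties as ℚᵘₚ
open import Data.Sign.Base using (Sign; +; -)
open import Data.Sign.Properties using () renaming (_≟_ to _≟ˢ_)
open import Data.Sum.Base using (_⊎_; inj₁; inj₂; [_,_]′; swap)
open import Data.Vec.Base using (Vec; []; _∷_; _++_; replicate; cast; count; lookup)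
open import Data.Vec.Properties
  using ( lookup∘tabulate; tabulate∘lookup; tabulate-cong; lookup-cast₁; lookup-++-<; lookup-++-≥
        ; lookup-replicate; count≤n)
open import Function.Base using (_∘_)
open import Level using (0ℓ; Lift; lift) renaming (suc to lsuc; lower to unlift)
import Relation.Binary.Construct.On as On
open import Relation.Binary.Definitions using (tri<; tri≈; tri>)
open import Relation.Binary.PropositionalEquality
  using (_≡_; refl; sym; trans; cong; subst; subst₂; isEquivalence; module ≡-Reasoning)
open import Relation.Nullary using (¬_; Dec; yes; no)
open import Relation.Unary using (Pred; Decidable; _⊆_; _≐_; _∪_; _∩_; Satisfiable)
open import Relation.Unary.Relation.Binary.Equality using (≐-isEquivalence)

open ℝ
open RawMonoidDefinitions ℚ.+-0-rawMonoid using () renaming (_×_ to _•_)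
open SemiringMult (CommutativeRing.semiring ℚₚ.+-*-commutativeRing) using (×-assoc-*)

-- Integer multiples of rationals

•-mono-≤ : ∀ k {p q} → p ℚ.≤ q → k • p ℚ.≤ k • q
•-mono-≤ zero    p≤q = ℚₚ.≤-refl
•-mono-≤ (suc k) p≤q = ℚₚ.+-mono-≤ p≤q (•-mono-≤ k p≤q)

•-mono-< : ∀ k {p q} → p ℚ.< q → suc k • p ℚ.< suc k • q
•-mono-< k p<q = ℚₚ.+-mono-<-≤ p<q (•-mono-≤ k (ℚₚ.<⇒≤ p<q))

•-cancel-< : ∀ k {p q} → k • p ℚ.< k • q → p ℚ.< q
•-cancel-< k kp<kq = ℚₚ.≰⇒> λ q≤p → ℚₚ.<-irrefl refl (ℚₚ.<-≤-trans kp<kq (•-mono-≤ k q≤p))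

•≡* : ∀ k p → k • p ≡ (k • 1ℚ) ℚ.* p
•≡* k p = sym (trans (×-assoc-* k 1ℚ p) (cong (k •_) (ℚₚ.*-identityˡ p)))

-- The unnormalised rationals add without reducing fractions, so there the induction step is an
-- identity of integers.
toℚᵘ-• : ∀ k → ℚ.toℚᵘ (k • 1ℚ) ℚᵘ.≃ mkℚᵘ (ℤ.+ k) 0
toℚᵘ-• zero    = ℚᵘₚ.≃-refl
toℚᵘ-• (suc k) = ℚᵘₚ.≃-trans (ℚₚ.toℚᵘ-homo-+ 1ℚ (k • 1ℚ))
  (ℚᵘₚ.≃-trans (ℚᵘₚ.+-congʳ (mkℚᵘ (ℤ.+ 1) 0) (toℚᵘ-• k))
    (*≡* (cong (λ i → (ℤ.+ 1 ℤ.+ i) ℤ.* ℤ.+ 1) (ℤₚ.*-identityʳ (ℤ.+ k)))))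

-- The absolute value of the numerator serves as `k`, because the denominator is at least 1.
≤-multiple-of-1 : ∀ p → ∃[ k ] p ℚ.≤ k • 1ℚ
≤-multiple-of-1 p@(mkℚ i d _) = ℤ.∣ i ∣ , ℚₚ.toℚᵘ-cancel-≤
  (ℚᵘₚ.≤-trans (ℚᵘ.*≤* (ℤₚ.≤-trans (ℤₚ.≤-reflexive (ℤₚ.*-identityʳ i)) (bound i)))
    (ℚᵘₚ.≤-reflexive (ℚᵘₚ.≃-sym (toℚᵘ-• ℤ.∣ i ∣))))
  where
  bound : ∀ i → i ℤ.≤ ℤ.+ ℤ.∣ i ∣ ℤ.* ℤ.+ suc d
  bound (ℤ.+ n)      =
    ℤₚ.≤-trans (ℤ.+≤+ (ℕₚ.m≤m*n n (suc d))) (ℤₚ.≤-reflexive (ℤₚ.pos-* n (suc d)))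
  bound (ℤ.-[1+ n ]) = ℤ.-≤+

archimedean : ∀ d {ε} → 0ℚ ℚ.< ε → ∃[ k ] d ℚ.≤ k • ε
archimedean d {ε} 0<ε = let k , d/ε≤k = ≤-multiple-of-1 (d ℚ.* 1/ε) in
  k , subst₂ ℚ._≤_ d/ε*ε≡d (sym (•≡* k ε)) (ℚₚ.*-monoʳ-≤-nonNeg ε d/ε≤k)
  where
  instance
    pos : ℚ.Positive ε
    pos = ℚ.positive 0<ε
    nonNeg : ℚ.NonNegative ε
    nonNeg = ℚₚ.pos⇒nonNeg ε
    nonZero : ℚ.NonZero ε
    nonZero = ℚₚ.pos⇒nonZero ε
  1/ε : ℚ
  1/ε = ℚ.1/ ε
  d/ε*ε≡d : d ℚ.* 1/ε ℚ.* ε ≡ d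
  d/ε*ε≡d = trans (ℚₚ.*-assoc d 1/ε ε)
    (trans (cong (d ℚ.*_) (ℚₚ.*-inverseˡ ε)) (ℚₚ.*-identityʳ d))

-- Convex open sets are connected

-- The last two premises say that `x` lies between `p` and `q`, ends included. The ends are rational
-- because bisection produces only rational ends.
Convex : Subset → Set₁
Convex C = ∀ {p q} x → p ℚ.< q → C (fromℚ p) → C (fromℚ q) →
  (∀ {t} → t ℚ.< p → Lo x t) → (∀ {t} → q ℚ.< t → Hi x t) → C x

∩-open : ∀ {U V} → Open U → Open V → Open (U ∩ V)
∩-open oU oV {x} (u , v) with oU u | oV v
... | p , q , lp , hq , U⊇ | p′ , q′ , lp′ , hq′ , V⊇ =
  p ℚ.⊔ p′ , q ℚ.⊓ q′ , lo-⊔ , hi-⊓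
  , λ {y} l h → U⊇ (lo-≤ y (ℚₚ.p≤p⊔q p p′) l) (hi-≤ y (ℚₚ.p⊓q≤p q q′) h)
              , V⊇ (lo-≤ y (ℚₚ.p≤q⊔p p p′) l) (hi-≤ y (ℚₚ.p⊓q≤q q q′) h)
  where
  lo-≤ : ∀ y {a b} → a ℚ.≤ b → Lo y b → Lo y a
  lo-≤ y a≤b l = let c , b<c , l′ = lo-open y l in lo-down y (ℚₚ.≤-<-trans a≤b b<c) l′
  hi-≤ : ∀ y {a b} → a ℚ.≤ b → Hi y a → Hi y b
  hi-≤ y a≤b h = let c , c<a , h′ = hi-open y h in hi-up y (ℚₚ.<-≤-trans c<a a≤b) h′
  lo-⊔ : Lo x (p ℚ.⊔ p′)
  lo-⊔ with ℚₚ.⊔-sel p p′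
  ... | inj₁ eq = subst (Lo x) (sym eq) lp
  ... | inj₂ eq = subst (Lo x) (sym eq) lp′
  hi-⊓ : Hi x (q ℚ.⊓ q′)
  hi-⊓ with ℚₚ.⊓-sel q q′
  ... | inj₁ eq = subst (Hi x) (sym eq) hq
  ... | inj₂ eq = subst (Hi x) (sym eq) hq′

-- Provides the rational ends from which bisection starts.
open⇒rational-point : ∀ {U} → Open U → Satisfiable U → ∃[ p ] U (fromℚ p)
open⇒rational-point oU (x , x∈U) with oU x∈U
... | p , q , lp , hq , ⊆U =
  let m , p<m , m<q = ℚₚ.<-dense (lo<hi x lp hq) in m , ⊆U p<m m<q

module Bisection {C U V : Subset} (C⊆U∪V : C ⊆ U ∪ V) (convex : Convex C) where

  record Bracket : Set₁ where
    field
      lo hi : ℚ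
      lo<hi′ : lo ℚ.< hi
      lo∈C : C (fromℚ lo)
      hi∈C : C (fromℚ hi)
      lo∈U : U (fromℚ lo)
      hi∈V : V (fromℚ hi)
    width : ℚ
    width = hi ℚ.- lo

  open Bracket

  module Midpoint (B : Bracket) where
    mid : ℚ
    mid = lo B ℚ.+ ½ ℚ.* width B

    lo<mid : lo B ℚ.< mid
    lo<mid = p<p+ε (lo B) (0<½ε (0<q-p (lo<hi′ B)))

    mid≡ : mid ≡ hi B ℚ.- ½ ℚ.* width B
    mid≡ = solve 2 (λ a b → a :+ con ½ :* (b :- a) := b :- con ½ :* (b :- a)) refl (lo B) (hi B)
      where open +-*-Solver

    mid<hi : mid ℚ.< hi B
    mid<hi = subst (ℚ._< hi B) (sym mid≡) (p-ε<p (hi B) (0<½ε (0<q-p (lo<hi′ B))))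

    mid∈C : C (fromℚ mid)
    mid∈C = convex (fromℚ mid) (lo<hi′ B) (lo∈C B) (hi∈C B)
      (λ t<lo → ℚₚ.<-trans t<lo lo<mid) (λ hi<t → ℚₚ.<-trans mid<hi hi<t)

    mid-lo : mid ℚ.- lo B ≡ ½ ℚ.* width B
    mid-lo = solve 2 (λ a w → a :+ w :- a := w) refl (lo B) (½ ℚ.* width B)
      where open +-*-Solver

    hi-mid : hi B ℚ.- mid ≡ ½ ℚ.* width B
    hi-mid = trans (cong (λ m → hi B ℚ.- m) mid≡)
      (solve 2 (λ b w → b :- (b :- w) := w) refl (hi B) (½ ℚ.* width B))
      where open +-*-Solver

  open Midpoint

  record Halving (B : Bracket) : Set₁ where
    field
      half       : Bracket
      lo≤        : lo B ℚ.≤ lo half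
      hi≤        : hi half ℚ.≤ hi B
      half-width : width half ≡ ½ ℚ.* width B

  open Halving

  -- The midpoint lies in `C` by convexity, and the cover itself decides between `U` and `V` there.
  -- Either answer leaves a half whose left end is in `U` and whose right end is in `V`.
  halve : ∀ B → Halving B
  halve B = choose (C⊆U∪V (mid∈C B))
    where
    choose : U (fromℚ (mid B)) ⊎ V (fromℚ (mid B)) → Halving B
    choose (inj₁ mid∈U) = record
      { half = record
        { lo = mid B ; hi = hi B ; lo<hi′ = mid<hi B ; lo∈C = mid∈C B ; hi∈C = hi∈C B
        ; lo∈U = mid∈U ; hi∈V = hi∈V B }
      ; lo≤ = ℚₚ.<⇒≤ (lo<mid B) ; hi≤ = ℚₚ.≤-refl ; half-width = hi-mid B }
    choose (inj₂ mid∈V) = record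
      { half = record
        { lo = lo B ; hi = mid B ; lo<hi′ = lo<mid B ; lo∈C = lo∈C B ; hi∈C = mid∈C B
        ; lo∈U = lo∈U B ; hi∈V = mid∈V }
      ; lo≤ = ℚₚ.≤-refl ; hi≤ = ℚₚ.<⇒≤ (mid<hi B) ; half-width = mid-lo B }

  module Limit (B : Bracket) where

    seq : ℕ → Bracket
    seq zero    = B
    seq (suc k) = half (halve (seq k))

    lo-mono′ : ∀ {j k} → j ℕ.≤′ k → lo (seq j) ℚ.≤ lo (seq k)
    lo-mono′ ℕ.≤′-refl           = ℚₚ.≤-refl
    lo-mono′ (ℕ.≤′-step {k} j≤k) =
      ℚₚ.≤-trans (lo-mono′ j≤k) (lo≤ (halve (seq k)))

    hi-mono′ : ∀ {j k} → j ℕ.≤′ k → hi (seq k) ℚ.≤ hi (seq j)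
    hi-mono′ ℕ.≤′-refl           = ℚₚ.≤-refl
    hi-mono′ (ℕ.≤′-step {k} j≤k) =
      ℚₚ.≤-trans (hi≤ (halve (seq k))) (hi-mono′ j≤k)

    lo-mono : ∀ {j k} → j ℕ.≤ k → lo (seq j) ℚ.≤ lo (seq k)
    lo-mono = lo-mono′ ∘ ℕₚ.≤⇒≤′

    hi-mono : ∀ {j k} → j ℕ.≤ k → hi (seq k) ℚ.≤ hi (seq j)
    hi-mono = hi-mono′ ∘ ℕₚ.≤⇒≤′

    lo<hi-seq : ∀ j k → lo (seq j) ℚ.< hi (seq k)
    lo<hi-seq j k = ℚₚ.≤-<-trans (lo-mono (ℕₚ.m≤m⊔n j k))
      (ℚₚ.<-≤-trans (lo<hi′ (seq (j ℕ.⊔ k))) (hi-mono (ℕₚ.m≤n⊔m j k)))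

    -- A linear bound is enough and avoids powers of 2. In the induction step, two of the `k + 2`
    -- halves make one whole width, and each of the other `k` is at most a whole one.
    width-bound : ∀ k → suc k • width (seq k) ℚ.≤ width B
    width-bound zero    = ℚₚ.≤-reflexive (ℚₚ.+-identityʳ (width B))
    width-bound (suc k) = ℚₚ.≤-trans (subst (λ w′ → suc (suc k) • w′ ℚ.≤ suc k • w)
        (sym (half-width (halve (seq k)))) step) (width-bound k)
      where
      w : ℚ
      w = width (seq k)
      0<w : 0ℚ ℚ.< w
      0<w = 0<q-p (lo<hi′ (seq k))
      two-halves : ½ ℚ.* w ℚ.+ ½ ℚ.* w ≡ w
      two-halves = solve 1 (λ w → con ½ :* w :+ con ½ :* w := w) refl w
        where open +-*-Solver
      ½w≤w : ½ ℚ.* w ℚ.≤ w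
      ½w≤w = ℚₚ.<⇒≤ (subst (½ ℚ.* w ℚ.<_) two-halves (p<p+ε (½ ℚ.* w) (0<½ε 0<w)))
      step : suc (suc k) • (½ ℚ.* w) ℚ.≤ suc k • w
      step = subst (ℚ._≤ suc k • w) (ℚₚ.+-assoc (½ ℚ.* w) (½ ℚ.* w) (k • (½ ℚ.* w)))
        (ℚₚ.+-mono-≤ (ℚₚ.≤-reflexive two-halves) (•-mono-≤ k ½w≤w))

    width-small : ∀ {ε} → 0ℚ ℚ.< ε → ∃[ k ] width (seq k) ℚ.< ε
    width-small {ε} 0<ε = let k , d≤kε = archimedean (width B) 0<ε in
      -- `k + 1` times the width is at most `width B`, hence at most `k • ε`, hence less than
      -- `suc k • ε`.
      k , •-cancel-< (suc k) (ℚₚ.≤-<-trans (ℚₚ.≤-trans (width-bound k) d≤kε)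
        (subst (ℚ._< suc k • ε) (ℚₚ.+-identityˡ (k • ε)) (ℚₚ.+-monoˡ-< (k • ε) 0<ε)))

    limit : ℝ
    limit = record
      { Lo       = λ q → ∃[ k ] q ℚ.< lo (seq k)
      ; Hi       = λ q → ∃[ k ] hi (seq k) ℚ.< q
      ; lo-down  = λ p<q (k , q<lo) → k , ℚₚ.<-trans p<q q<lo
      ; lo-open  = λ (k , p<lo) → let m , p<m , m<lo = ℚₚ.<-dense p<lo in m , p<m , k , m<lo
      ; hi-up    = λ p<q (k , hi<p) → k , ℚₚ.<-trans hi<p p<q
      ; hi-open  = λ (k , hi<q) → let m , hi<m , m<q = ℚₚ.<-dense hi<q in m , m<q , k , hi<m
      ; disjoint = λ ((j , p<lo) , (k , hi<p)) →
          ℚₚ.<-asym (lo<hi-seq j k) (ℚₚ.<-trans hi<p p<lo)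
      ; located  = λ {ε} 0<ε →
          -- At a stage narrower than `ε`, `hi - ε` is below `lo`. A `p` strictly between them is a
          -- lower bound of the limit, and `p + ε` exceeds `hi`.
          let k , w<ε = width-small 0<ε
              p , hi-ε<p , p<lo = ℚₚ.<-dense (hi-ε<lo (seq k) w<ε)
          in p , (k , p<lo) , k , subst (ℚ._< p ℚ.+ ε) (cancel (hi (seq k)) ε) (ℚₚ.+-monoˡ-< ε hi-ε<p)
      }
      where
      cancel : ∀ b ε → b ℚ.- ε ℚ.+ ε ≡ b
      cancel = solve 2 (λ b ε → b :- ε :+ ε := b) refl
        where open +-*-Solver
      hi-ε<lo : ∀ B′ {ε} → width B′ ℚ.< ε → hi B′ ℚ.- ε ℚ.< lo B′
      hi-ε<lo B′ {ε} w<ε = subst₂ ℚ._<_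
        (solve 3 (λ a b ε → b :- a :+ (a :- ε) := b :- ε) refl (lo B′) (hi B′) ε)
        (solve 2 (λ a ε → ε :+ (a :- ε) := a) refl (lo B′) ε)
        (ℚₚ.+-monoˡ-< (lo B′ ℚ.- ε) w<ε)
        where open +-*-Solver

    limit∈C : C limit
    limit∈C = convex limit (lo<hi′ B) (lo∈C B) (hi∈C B) (zero ,_) (zero ,_)

  -- If the limit is in `U`, a whole interval around it is, and this contains the right end of some
  -- bracket, a point of `V`. If the limit is in `V`, some left end does the same.
  meet : Open U → Open V → Bracket → Satisfiable (C ∩ (U ∩ V))
  meet oU oV B with C⊆U∪V (Limit.limit∈C B)
  ... | inj₁ limit∈U with oU limit∈U
  ...   | p , q , (j , p<lo) , (k , hi<q) , ⊆U = fromℚ (hi (seq k)) , hi∈C (seq k)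
          , ⊆U (ℚₚ.<-trans p<lo (lo<hi-seq j k)) hi<q , hi∈V (seq k)
    where open Limit B
  meet oU oV B | inj₂ limit∈V with oV limit∈V
  ...   | p , q , (j , p<lo) , (k , hi<q) , ⊆V = fromℚ (lo (seq j)) , lo∈C (seq j)
          , lo∈U (seq j) , ⊆V p<lo (ℚₚ.<-trans (lo<hi-seq j k) hi<q)
    where open Limit B

-- Since `C` is open, both intersections contain rational points, which can be compared. If the
-- point of `V` comes first, `U` and `V` exchange roles.
convex-open⇒connected : ∀ {C} → Open C → Convex C → Connected C
convex-open⇒connected {C} oC convex {U} {V} oU oV C⊆U∪V C∩U C∩V =
  meet (open⇒rational-point (∩-open oC oU) C∩U) (open⇒rational-point (∩-open oC oV) C∩V)
  where
  meet : ∃[ p ] (C ∩ U) (fromℚ p) → ∃[ q ] (C ∩ V) (fromℚ q) → Satisfiable (C ∩ (U ∩ V))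
  meet (p , p∈C , p∈U) (q , q∈C , q∈V) with ℚₚ.<-cmp p q
  ... | tri≈ _ refl _ = fromℚ p , p∈C , p∈U , q∈V
  ... | tri< p<q _ _  = Bisection.meet {C} {U} {V} C⊆U∪V convex oU oV record
    { lo = p ; hi = q ; lo<hi′ = p<q ; lo∈C = p∈C ; hi∈C = q∈C ; lo∈U = p∈U ; hi∈V = q∈V }
  ... | tri> _ _ q<p  =
    let x , x∈C , x∈V , x∈U = Bisection.meet {C} {V} {U} (swap ∘ C⊆U∪V) convex oV oU record
          { lo = q ; hi = p ; lo<hi′ = q<p ; lo∈C = q∈C ; hi∈C = p∈C ; lo∈U = q∈V ; hi∈V = p∈U }
    in x , x∈C , x∈U , x∈V

-- The point of H i is the root of the i-th form

multiple-positive : ∀ k → 0ℚ ℚ.< suc k • 1ℚ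
multiple-positive zero    = ℚₚ.positive⁻¹ 1ℚ
multiple-positive (suc k) = ℚₚ.+-mono-< (ℚₚ.positive⁻¹ 1ℚ) (multiple-positive k)

module _ (k : ℕ) where

  private
    c : ℚ
    c = suc k • 1ℚ
    instance
      c-pos : ℚ.Positive c
      c-pos = ℚ.positive (multiple-positive k)
      c-nonZero : ℚ.NonZero c
      c-nonZero = ℚₚ.pos⇒nonZero c

  abstract
    -- This is -1/(k+1), with the same index shift as in `form`. It is kept abstract, being known
    -- afterwards only through `•-root` and `root<0`.
    root : ℚ
    root = ℚ.- ℚ.1/ c

    •-root : suc k • root ≡ ℚ.- 1ℚ
    •-root = begin
      suc k • root            ≡⟨ •≡* (suc k) root ⟩
      c ℚ.* (ℚ.- ℚ.1/ c)      ≡⟨ ℚₚ.neg-distribʳ-* c (ℚ.1/ c) ⟨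
      ℚ.- (c ℚ.* ℚ.1/ c)      ≡⟨ cong ℚ.-_ (ℚₚ.*-inverseʳ c) ⟩
      ℚ.- 1ℚ                  ∎
      where open ≡-Reasoning

    root<0 : root ℚ.< 0ℚ
    root<0 = ℚₚ.neg-antimono-< (ℚₚ.positive⁻¹ (ℚ.1/ c) {{ℚₚ.1/pos⇒pos c}})

-- Multiply by `k + 2`: the left side becomes `root k - 1`, which is below -1, and the right side
-- becomes -1.
root-step : ∀ k → root k ℚ.< root (suc k)
root-step k = •-cancel-< (suc (suc k)) (subst₂ ℚ._<_ refl (sym (•-root (suc k)))
  (subst (root k ℚ.+ suc k • root k ℚ.<_) (ℚₚ.+-identityˡ (ℚ.- 1ℚ))
    (ℚₚ.+-mono-<-≤ (root<0 k) (ℚₚ.≤-reflexive (•-root k)))))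

root-mono-≤ : ∀ {j k} → j ℕ.≤′ k → root j ℚ.≤ root k
root-mono-≤ ℕ.≤′-refl           = ℚₚ.≤-refl
root-mono-≤ (ℕ.≤′-step {k} j≤k) = ℚₚ.≤-trans (root-mono-≤ j≤k) (ℚₚ.<⇒≤ (root-step k))

-- The point lies left of the first root if `m` is 0, and otherwise between two consecutive roots.
-- The sequence of roots is infinite, so the cell to the right of all `n` roots needs no case of its
-- own.
separate-roots : ∀ m → ∃[ q ] (∀ k → k ℕ.< m → root k ℚ.< q) × (∀ k → m ℕ.≤ k → q ℚ.< root k)
separate-roots zero    = root 0 ℚ.- 1ℚ , (λ _ ())
  , λ _ 0≤k → ℚₚ.<-≤-trans (p-ε<p (root 0) (ℚₚ.positive⁻¹ 1ℚ)) (root-mono-≤ (ℕₚ.≤⇒≤′ 0≤k))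
separate-roots (suc m) =
  let q , rₘ<q , q<rₘ₊₁ = ℚₚ.<-dense (root-step m)
  in q , (λ { _ (ℕ.s≤s k≤m) → ℚₚ.≤-<-trans (root-mono-≤ (ℕₚ.≤⇒≤′ k≤m)) rₘ<q })
       , λ _ m<k → ℚₚ.<-≤-trans q<rₘ₊₁ (root-mono-≤ (ℕₚ.≤⇒≤′ m<k))

-- The sign of a form and the position relative to its root

p+q<r⇒q<r-p : ∀ p {q r} → p ℚ.+ q ℚ.< r → q ℚ.< r ℚ.- p
p+q<r⇒q<r-p p {q} {r} p+q<r = subst (ℚ._< r ℚ.- p)
  (solve 2 (λ p q → p :+ q :- p := q) refl p q) (ℚₚ.+-monoˡ-< (ℚ.- p) p+q<r)
  where open +-*-Solver

p<q+r⇒p-q<r : ∀ q {p r} → p ℚ.< q ℚ.+ r → p ℚ.- q ℚ.< r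
p<q+r⇒p-q<r q {p} {r} p<q+r = subst (p ℚ.- q ℚ.<_)
  (solve 2 (λ q r → q :+ r :- q := r) refl q r) (ℚₚ.+-monoˡ-< (ℚ.- q) p<q+r)
  where open +-*-Solver

-- Split `b` as `c + (b - c)` and recurse. The inequality is strict because the base case asks for
-- `0 < b`.
Hi-·⁺ : ∀ k x {b c} → k • c ℚ.< b → Hi x c → Hi (k · x) b
Hi-·⁺ zero    x         0<b    h = 0<b
Hi-·⁺ (suc k) x {b} {c} c+kc<b h =
  c , b ℚ.- c , h , Hi-·⁺ k x (p+q<r⇒q<r-p c c+kc<b) h , sym (shift c b)

Lo-·⁺ : ∀ k x {b c} → b ℚ.< k • c → Lo x c → Lo (k · x) b
Lo-·⁺ zero    x         b<0    l = b<0
Lo-·⁺ (suc k) x {b} {c} b<c+kc l =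
  c , b ℚ.- c , l , Lo-·⁺ k x (p<q+r⇒p-q<r c b<c+kc) l , sym (shift c b)

-- Pigeonhole: `b` is a sum of `k` upper bounds of `x` and a positive rest, so these bounds cannot
-- all exceed `c`. No division of a cut is involved.
Hi-·⁻ : ∀ k x {b c} → b ℚ.≤ k • c → Hi (k · x) b → Hi x c
Hi-·⁻ zero    x     b≤0  0<b = ⊥-elim (ℚₚ.<-irrefl refl (ℚₚ.<-≤-trans 0<b b≤0))
Hi-·⁻ (suc k) x {c = c} b≤c+kc (a , d , ha , hd , refl) with ℚₚ.<-cmp a c
... | tri< a<c _ _  = hi-up x a<c ha
... | tri≈ _ refl _ = ha
... | tri> _ _ c<a  = Hi-·⁻ k x (ℚₚ.≮⇒≥ λ kc<d →
  ℚₚ.<-irrefl refl (ℚₚ.≤-<-trans b≤c+kc (ℚₚ.+-mono-< c<a kc<d))) hd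

Lo-·⁻ : ∀ k x {b c} → k • c ℚ.≤ b → Lo (k · x) b → Lo x c
Lo-·⁻ zero    x     0≤b  b<0 = ⊥-elim (ℚₚ.<-irrefl refl (ℚₚ.<-≤-trans b<0 0≤b))
Lo-·⁻ (suc k) x {c = c} c+kc≤b (a , d , la , ld , refl) with ℚₚ.<-cmp a c
... | tri> _ _ c<a  = lo-down x c<a la
... | tri≈ _ refl _ = la
... | tri< a<c _ _  = Lo-·⁻ k x (ℚₚ.≮⇒≥ λ d<kc →
  ℚₚ.<-irrefl refl (ℚₚ.<-≤-trans (ℚₚ.+-mono-< a<c d<kc) c+kc≤b)) ld

-- From `1 < a` and `a + b < 0` it follows that `b` is at most -1, which is `suc k • root k`.
form<0⇒Hi : ∀ k x → 1ℝ +ℝ suc k · x < 0ℝ → Hi x (root k)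
form<0⇒Hi k x (_ , (a , b , 1<a , hb , refl) , a+b<0) =
  Hi-·⁻ (suc k) x (subst (b ℚ.≤_) (sym (•-root k)) (ℚₚ.≮⇒≥ λ -1<b →
    ℚₚ.<-asym a+b<0 (ℚₚ.+-mono-< 1<a -1<b))) hb

0<form⇒Lo : ∀ k x → 0ℝ < 1ℝ +ℝ suc k · x → Lo x (root k)
0<form⇒Lo k x (_ , 0<a+b , (a , b , a<1 , lb , refl)) =
  Lo-·⁻ (suc k) x (subst (ℚ._≤ b) (sym (•-root k)) (ℚₚ.≮⇒≥ λ b<-1 →
    ℚₚ.<-asym 0<a+b (ℚₚ.+-mono-< a<1 b<-1))) lb

-- Openness of the cut gives room for three choices in turn: `c` below the root, then `b` between
-- `suc k • c` and -1, then `a` between 1 and `- b`.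
Hi⇒form<0 : ∀ k x → Hi x (root k) → 1ℝ +ℝ suc k · x < 0ℝ
Hi⇒form<0 k x h =
  let c , c<root , hc  = hi-open x h
      b , kc<b , b<-1  = ℚₚ.<-dense (subst (suc k • c ℚ.<_) (•-root k) (•-mono-< k c<root))
      a , 1<a , a<-b   = ℚₚ.<-dense (ℚₚ.neg-antimono-< b<-1)
  in a ℚ.+ b , (a , b , 1<a , Hi-·⁺ (suc k) x kc<b hc , refl)
   , subst (a ℚ.+ b ℚ.<_) (ℚₚ.+-inverseˡ b) (ℚₚ.+-monoˡ-< b a<-b)

Lo⇒0<form : ∀ k x → Lo x (root k) → 0ℝ < 1ℝ +ℝ suc k · x
Lo⇒0<form k x l =
  let c , root<c , lc  = lo-open x l
      b , -1<b , b<kc  = ℚₚ.<-dense (subst (ℚ._< suc k • c) (•-root k) (•-mono-< k root<c))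
      a , -b<a , a<1   = ℚₚ.<-dense (ℚₚ.neg-antimono-< -1<b)
  in a ℚ.+ b , subst (ℚ._< a ℚ.+ b) (ℚₚ.+-inverseˡ b) (ℚₚ.+-monoˡ-< b -b<a)
   , (a , b , a<1 , Lo-·⁺ (suc k) x b<kc lc , refl)

-- Cells of a sign word

-- Phrased by the root instead of the sign of the form, so that openness and convexity can be read
-- off the cut. `Lift` only adjusts the universe level.
Side : Sign → ℕ → Subset
Side + k x = Lift (lsuc 0ℓ) (Lo x (root k))
Side - k x = Lift (lsuc 0ℓ) (Hi x (root k))

Cell : ∀ {n} → Vec Sign n → Subset
Cell w x = ∀ i → Side (lookup w i) (toℕ i) x

Side-open : ∀ s k → Open (Side s k)
Side-open + k {x} (lift l) =
  let p , root<p , lp = lo-open x l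
      -- A half-line restricts one end only; the other end of the interval is any bound of `x`, here
      -- one obtained from `located` with width 1.
      q , _ , hq      = located x (ℚₚ.positive⁻¹ 1ℚ)
  in p , _ , lp , hq , λ {y} lp _ → lift (lo-down y root<p lp)
Side-open - k {x} (lift h) =
  let q , q<root , hq = hi-open x h
      p , lp , _      = located x (ℚₚ.positive⁻¹ 1ℚ)
  in p , q , lp , hq , λ {y} _ hq → lift (hi-up y q<root hq)

⋂-open : ∀ n {U : Fin n → Subset} → (∀ i → Open (U i)) → Open (λ x → ∀ i → U i x)
⋂-open zero    oU {x} _   = let p , lp , hp = located x (ℚₚ.positive⁻¹ 1ℚ)
  in p , _ , lp , hp , λ _ _ ()
⋂-open (suc n) {U} oU x∈U =
  let p , q , lp , hq , ⊆U = ∩-open (oU zero) (⋂-open n (oU ∘ suc)) (x∈U zero , x∈U ∘ suc)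
  in p , q , lp , hq
   , λ l h → λ { zero → proj₁ (⊆U l h) ; (suc i) → proj₂ (⊆U l h) i }

Side-convex : ∀ s k → Convex (Side s k)
Side-convex + k x p<q (lift root<p) _ lo _ = lift (lo root<p)
Side-convex - k x p<q _ (lift q<root) _ hi = lift (hi q<root)

Cell-connected : ∀ {n} (w : Vec Sign n) → Connected (Cell w)
Cell-connected w = convex-open⇒connected
  (⋂-open _ λ i → Side-open (lookup w i) (toℕ i))
  (λ x p<q p∈ q∈ lo hi i → Side-convex (lookup w i) (toℕ i) x p<q (p∈ i) (q∈ i) lo hi)

Side⇒# : ∀ s k x → Side s k x → 1ℝ +ℝ suc k · x # 0ℝ
Side⇒# + k x (lift l) = inj₂ (Lo⇒0<form k x l)
Side⇒# - k x (lift h) = inj₁ (Hi⇒form<0 k x h)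

sgn-Side : ∀ {n} (i : Fin n) x (x# : form i x # 0ℝ) → Side (sgn (form i x) x#) (toℕ i) x
sgn-Side i x (inj₁ f<0) = lift (form<0⇒Hi (toℕ i) x f<0)
sgn-Side i x (inj₂ 0<f) = lift (0<form⇒Lo (toℕ i) x 0<f)

Side-unique : ∀ s t k {x} → Side s k x → Side t k x → s ≡ t
Side-unique + + k _ _ = refl
Side-unique - - k _ _ = refl
Side-unique + - k {x} (lift l) (lift h) = ⊥-elim (disjoint x (l , h))
Side-unique - + k {x} (lift h) (lift l) = ⊥-elim (disjoint x (l , h))

Cell⊆Complement : ∀ {n} (w : Vec Sign n) → Cell w ⊆ Complement n
Cell⊆Complement w {x} x∈ = lift λ i → Side⇒# (lookup w i) (toℕ i) x (x∈ i)

signs-Cell : ∀ {n} x (x∈ : Complement n x) → Cell (signs x x∈) x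
signs-Cell x (lift x#) i = subst (λ s → Side s (toℕ i) x)
  (sym (lookup∘tabulate (λ i → sgn (form i x) (x# i)) i)) (sgn-Side i x (x# i))

Cell-unique : ∀ {n} (v w : Vec Sign n) {x} → Cell v x → Cell w x → v ≡ w
Cell-unique v w x∈v x∈w = trans (sym (tabulate∘lookup v)) (trans
  (tabulate-cong λ i → Side-unique (lookup v i) (lookup w i) (toℕ i) (x∈v i) (x∈w i))
  (tabulate∘lookup w))

-- If D met both sides of the root, they would split it.
same-Side : ∀ {n D} → D ⊆ Complement n → Connected D → ∀ (i : Fin n) s t {x y} →
  D x → D y → Side s (toℕ i) x → Side t (toℕ i) y → s ≡ t
same-Side D⊆ conn i + + _ _ _ _ = refl
same-Side D⊆ conn i - - _ _ _ _ = refl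
same-Side D⊆ conn i - + x∈D y∈D xs yt = sym (same-Side D⊆ conn i + - y∈D x∈D yt xs)
same-Side {D = D} D⊆ conn i + - x∈D y∈D xs yt =
  let z , _ , z+ , z- = conn {Side + k} {Side - k}
        (λ {x} → Side-open + k {x}) (λ {x} → Side-open - k {x}) cover (_ , x∈D , xs) (_ , y∈D , yt)
  in Side-unique + - k {z} z+ z-
  where
  k : ℕ
  k = toℕ i
  cover : D ⊆ Side + k ∪ Side - k
  cover {z} z∈D = [ (λ f<0 → inj₂ (lift (form<0⇒Hi k z f<0)))
                  , (λ 0<f → inj₁ (lift (0<form⇒Lo k z 0<f))) ]′ (unlift (D⊆ z∈D) i)

-- Chambers as inhabited cells

same-Cell : ∀ {n D} → D ⊆ Complement n → Connected D → ∀ (w : Vec Sign n) {x} →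
  D x → Cell w x → D ⊆ Cell w
same-Cell {D = D} D⊆ conn w x∈D x∈w {y} y∈D i =
  subst (λ s → Side s (toℕ i) y)
    (same-Side {D = D} D⊆ conn i _ _ y∈D x∈D y∈s (x∈w i)) y∈s
  where
  y∈s = sgn-Side i y (unlift (D⊆ y∈D) i)

-- The cell is a connected subset of the complement containing the chamber, so maximality of the
-- chamber gives the converse inclusion.
chamber≐Cell : ∀ {n} (C : Chamber n) → carrier C ≐ Cell (σ C)
chamber≐Cell C = C⊆Cell , maximal C (Cell⊆Complement (σ C)) (Cell-connected (σ C)) C⊆Cell
  where
  C⊆Cell : carrier C ⊆ Cell (σ C)
  C⊆Cell = let x , x∈C = inhabited C in
    same-Cell {D = carrier C} (contained C) (connected C) (σ C) x∈C (signs-Cell x (contained C x∈C))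

-- For maximality, a connected `D` containing the cell contains its point `x`, so `same-Cell`
-- confines `D` to the cell.
cell-chamber : ∀ {n} (w : Vec Sign n) → Satisfiable (Cell w) → Chamber n
cell-chamber w nonempty@(x , x∈w) = record
  { carrier   = Cell w
  ; inhabited = nonempty
  ; contained = Cell⊆Complement w
  ; connected = Cell-connected w
  ; maximal   = λ {D} D⊆ conn w⊆D → same-Cell {D = D} D⊆ conn w (w⊆D {x} x∈w) x∈w
  }

-- Makes the sign word independent of the point at which it is read.
Cell⇒σ≡ : ∀ {n} (C : Chamber n) w → carrier C ⊆ Cell w → σ C ≡ w
Cell⇒σ≡ C w C⊆w = let x , x∈C = inhabited C in
  Cell-unique (σ C) w {x} (proj₁ (chamber≐Cell C) x∈C) (C⊆w x∈C)

-- Block words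

module _ {a} {A : Set a} where

  lookup-blocks-< : ∀ {n} (x y : A) (r : Fin (suc n)) (i : Fin n) →
    toℕ i ℕ.< n ∸ toℕ r → lookup (blocks x y r) i ≡ x
  lookup-blocks-< {n} x y r i i<n-r = trans
    (lookup-cast₁ (ℕₚ.m∸n+n≡m (toℕ≤pred[n] r)) (replicate (n ∸ toℕ r) x ++ replicate (toℕ r) y) i)
    (trans (lookup-++-< (replicate (n ∸ toℕ r) x) (replicate (toℕ r) y) j j<n-r)
      (lookup-replicate (Fin.fromℕ< j<n-r) x))
    where
    j = Fin.cast (sym (ℕₚ.m∸n+n≡m (toℕ≤pred[n] r))) i
    j<n-r : toℕ j ℕ.< n ∸ toℕ r
    j<n-r = subst (ℕ._< n ∸ toℕ r) (sym (toℕ-cast _ i)) i<n-r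

  lookup-blocks-≥ : ∀ {n} (x y : A) (r : Fin (suc n)) (i : Fin n) →
    n ∸ toℕ r ℕ.≤ toℕ i → lookup (blocks x y r) i ≡ y
  lookup-blocks-≥ {n} x y r i n-r≤i = trans
    (lookup-cast₁ (ℕₚ.m∸n+n≡m (toℕ≤pred[n] r)) (replicate (n ∸ toℕ r) x ++ replicate (toℕ r) y) i)
    (trans (lookup-++-≥ (replicate (n ∸ toℕ r) x) (replicate (toℕ r) y) j n-r≤j)
      (lookup-replicate (Fin.reduce≥ j n-r≤j) y))
    where
    j = Fin.cast (sym (ℕₚ.m∸n+n≡m (toℕ≤pred[n] r))) i
    n-r≤j : n ∸ toℕ r ℕ.≤ toℕ j
    n-r≤j = subst (n ∸ toℕ r ℕ.≤_) (sym (toℕ-cast _ i)) n-r≤i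

  module _ {p} {P : Pred A p} (P? : Decidable P) where

    count-cast : ∀ {m n} .(eq : m ≡ n) (xs : Vec A m) → count P? (cast eq xs) ≡ count P? xs
    count-cast {n = zero}  eq []       = refl
    count-cast {n = suc n} eq (x ∷ xs) with P? x
    ... | yes _ = cong suc (count-cast (ℕₚ.suc-injective eq) xs)
    ... | no  _ = count-cast (ℕₚ.suc-injective eq) xs

    count-replicate : ∀ {y} → P y → ∀ m → count P? (replicate m y) ≡ m
    count-replicate Py zero = refl
    count-replicate {y} Py (suc m) with P? y
    ... | yes _  = cong suc (count-replicate Py m)
    ... | no ¬Py = ⊥-elim (¬Py Py)

    count-replicate-++ : ∀ {x} → ¬ P x → ∀ m {n} (ys : Vec A n) →
      count P? (replicate m x ++ ys) ≡ count P? ys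
    count-replicate-++ ¬Px zero ys = refl
    count-replicate-++ {x} ¬Px (suc m) ys with P? x
    ... | yes Px = ⊥-elim (¬Px Px)
    ... | no _   = count-replicate-++ ¬Px m ys

    count-blocks : ∀ {n x y} → ¬ P x → P y → (r : Fin (suc n)) → count P? (blocks x y r) ≡ toℕ r
    count-blocks {n} {x} {y} ¬Px Py r = trans
      (count-cast (ℕₚ.m∸n+n≡m (toℕ≤pred[n] r)) (replicate (n ∸ toℕ r) x ++ replicate (toℕ r) y))
      (trans (count-replicate-++ ¬Px (n ∸ toℕ r) (replicate (toℕ r) y)) (count-replicate Py (toℕ r)))

-- Bijectivity of `Ψ`

count-Ψ : ∀ n C → count (𝕒 ≟_) (Ψ n C) ≡ toℕ (r C)
count-Ψ n C = count-blocks (𝕒 ≟_) (λ ()) refl (r C)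

-- `r` is extracted from an existence proof; counting minus signs recovers it from the sign word
-- alone.
count-σ : ∀ {n} (C : Chamber n) → count (- ≟ˢ_) (σ C) ≡ toℕ (r C)
count-σ C = trans (cong (count (- ≟ˢ_)) (proj₂ (σ-blocks C)))
  (count-blocks (- ≟ˢ_) (λ ()) refl (r C))

blocks-Cell : ∀ {n} (r : Fin (suc n)) → Satisfiable (Cell (blocks + - r))
blocks-Cell {n} r = fromℚ q , λ i → side i (toℕ i ℕₚ.<? n ∸ toℕ r)
  where
  q = proj₁ (separate-roots (n ∸ toℕ r))
  above = proj₁ (proj₂ (separate-roots (n ∸ toℕ r)))
  below = proj₂ (proj₂ (separate-roots (n ∸ toℕ r)))
  side : ∀ i → Dec (toℕ i ℕ.< n ∸ toℕ r) → Side (lookup (blocks + - r) i) (toℕ i) (fromℚ q)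
  side i (yes i<m) = subst (λ s → Side s (toℕ i) (fromℚ q))
    (sym (lookup-blocks-< + - r i i<m)) (lift (above (toℕ i) i<m))
  side i (no  i≮m) = subst (λ s → Side s (toℕ i) (fromℚ q))
    (sym (lookup-blocks-≥ + - r i (ℕₚ.≮⇒≥ i≮m))) (lift (below (toℕ i) (ℕₚ.≮⇒≥ i≮m)))

-- `C` lies in the cell of `σ D`, so both chambers have the same sign word, even if their witnesses
-- differ.
Ψ-cong : ∀ n {C D} → C ≈ᶜ D → Ψ n C ∼₁ Ψ n D
Ψ-cong n {C} {D} (C⊆D , _) = begin
  count (𝕒 ≟_) (Ψ n C)  ≡⟨ count-Ψ n C ⟩
  toℕ (r C)             ≡⟨ count-σ C ⟨
  count (- ≟ˢ_) (σ C)   ≡⟨ cong (count (- ≟ˢ_)) (Cell⇒σ≡ C (σ D) (proj₁ (chamber≐Cell D) ∘ C⊆D)) ⟩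
  count (- ≟ˢ_) (σ D)   ≡⟨ count-σ D ⟩
  toℕ (r D)             ≡⟨ count-Ψ n D ⟨
  count (𝕒 ≟_) (Ψ n D)  ∎
  where open ≡-Reasoning

-- The number of letters `𝕒` determines `r`, which determines the sign word, whose cell is the
-- chamber.
Ψ-injective : ∀ n {C D} → Ψ n C ∼₁ Ψ n D → C ≈ᶜ D
Ψ-injective n {C} {D} ΨC∼ΨD =
    proj₂ (chamber≐Cell D) ∘ subst (λ w → carrier C ⊆ Cell w) σC≡σD (proj₁ (chamber≐Cell C))
  , proj₂ (chamber≐Cell C) ∘ subst (λ w → carrier D ⊆ Cell w) (sym σC≡σD) (proj₁ (chamber≐Cell D))
  where
  rC≡rD : r C ≡ r D
  rC≡rD = toℕ-injective (trans (sym (count-Ψ n C)) (trans ΨC∼ΨD (count-Ψ n D)))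
  σC≡σD : σ C ≡ σ D
  σC≡σD = trans (proj₂ (σ-blocks C)) (trans (cong (blocks + -) rC≡rD) (sym (proj₂ (σ-blocks D))))

-- With `s` the number of letters `𝕒` in `w`, the cell of the block word with `s` minus signs is the
-- preimage. As `s` is at most `n`, it is a valid index in `Fin (suc n)`.
Ψ-surjective : ∀ n (w : Word n) → ∃[ C ] (∀ {D} → D ≈ᶜ C → Ψ n D ∼₁ w)
Ψ-surjective n w = cell-chamber (blocks + - s) (blocks-Cell s) , λ {D} (D⊆C , _) → begin
  count (𝕒 ≟_) (Ψ n D)               ≡⟨ count-Ψ n D ⟩
  toℕ (r D)                          ≡⟨ count-σ D ⟨
  count (- ≟ˢ_) (σ D)                ≡⟨ cong (count (- ≟ˢ_)) (Cell⇒σ≡ D (blocks + - s) D⊆C) ⟩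
  count (- ≟ˢ_) (blocks + - s)       ≡⟨ count-blocks (- ≟ˢ_) (λ ()) refl s ⟩
  toℕ s                              ≡⟨ toℕ-fromℕ< k<1+n ⟩
  count (𝕒 ≟_) w                     ∎
  where
  open ≡-Reasoning
  k<1+n : count (𝕒 ≟_) w ℕ.< suc n
  k<1+n = ℕ.s≤s (count≤n (𝕒 ≟_) w)
  s : Fin (suc n)
  s = Fin.fromℕ< k<1+n

proposition5 : (n : ℕ) → n ≥ 1 → IsBijection (_≈ᶜ_ {n}) (_∼₁_ {n}) (Ψ n)
proposition5 n _ = record
  { isInjection = record
    { isCongruent = record
      { cong           = λ {C} {D} → Ψ-cong n {C} {D}
      ; isEquivalence₁ = On.isEquivalence carrier ≐-isEquivalence
      ; isEquivalence₂ = On.isEquivalence (count (𝕒 ≟_)) isEquivalence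
      }
    ; injective   = λ {C} {D} → Ψ-injective n {C} {D}
    }
  ; surjective  = Ψ-surjective n
  }
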